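{- For every integer $a \ge 3$, the only (up to isomorphism) connected well-hued graph $G$ with $a_1 = a$ and $a_2 = a_1 + 2$ is the corona of a complete graph (that is, of the complete graph $K_a$).
   Context: All graphs are finite and simple. For $k\ge 1$, a maximal $k$-colorable subgraph of $G$ is a subgraph induced by a set $S\subseteq V(G)$ such that $G[S]$ is (properly) $k$-colorable and $G[S']$ is not $k$-colorable for every $S'$ with $S\subsetneq S'\subseteq V(G)$. $G$ is well-hued if for every $k\ge 1$ all maximal $k$-colorable subgraphs of $G$ have the same order, denoted $a_k$. The corona of a graph $H$ is the graph obtained from $H$ by attaching exactly one new pendant (leaf) vertex to each vertex of $H$. -}

module Defs where

open import Data.Empty using (⊥)
open import Data.Fin using (Fin; _≟_)
open import Data.Fin.Subset using (Subset; _∈_; _⊂_; ∣_∣)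
open import Data.Nat using (ℕ; _≤_)
open import Data.Product using (_×_; ∃; proj₁)
open import Data.Sum using (_⊎_; inj₁; inj₂)
open import Function using (_∘_)
open import Function.Bundles using (_↔_; _⇔_; Inverse)
open import Level using (0ℓ)
open import Relation.Binary.Construct.Closure.ReflexiveTransitive using (Star)
open import Relation.Binary.Core using (Rel)
open import Relation.Binary.Definitions using (Decidable; Irreflexive; Symmetric)
open import Relation.Binary.PropositionalEquality using (_≡_; _≢_; refl; sym; cong)
open import Relation.Nullary using (¬_; no; ¬?)

-- Finite graphs are those of type Graph (Fin n); arbitrary vertex types are
-- allowed so that induced subgraphs and coronas need no renumbering.
record Graph (V : Set) : Set₁ where
  field
    Adj    : Rel V 0ℓ
    adj?   : Decidable Adj
    irrefl : Irreflexive _≡_ Adj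
    symm   : Symmetric Adj

open Graph public

private
  variable
    V W : Set
    n : ℕ

Connected : Graph V → Set
Connected G = ∀ u v → Star (Adj G) u v

Colorable : ℕ → Graph V → Set
Colorable {V} k G =
  ∃ λ (c : V → Fin k) → ∀ u v → Adj G u v → c u ≢ c v

induced : Graph (Fin n) → (S : Subset n) → Graph (∃ λ v → v ∈ S)
induced G S = record
  { Adj    = λ u v → Adj G (proj₁ u) (proj₁ v)
  ; adj?   = λ u v → adj? G (proj₁ u) (proj₁ v)
  ; irrefl = λ u≡v → irrefl G (cong proj₁ u≡v)
  ; symm   = symm G
  }

MaximalColorable : Graph (Fin n) → ℕ → Subset n → Set
MaximalColorable G k S =
  Colorable k (induced G S) × (∀ T → S ⊂ T → ¬ Colorable k (induced G T))

WellHued : Graph (Fin n) → Set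
WellHued G = ∀ k → 1 ≤ k → ∀ S T →
  MaximalColorable G k S → MaximalColorable G k T → ∣ S ∣ ≡ ∣ T ∣

-- For well-hued G this says aₖ = m: one maximal k-colorable subgraph of
-- order m determines the common order.
HueOrder : Graph (Fin n) → ℕ → ℕ → Set
HueOrder G k m = ∃ λ S → MaximalColorable G k S × ∣ S ∣ ≡ m

complete : ∀ a → Graph (Fin a)
complete a = record
  { Adj    = _≢_
  ; adj?   = λ u v → ¬? (u ≟ v)
  ; irrefl = λ u≡v u≢v → u≢v u≡v
  ; symm   = λ u≢v → u≢v ∘ sym
  }

-- inj₁ v is the original vertex v and inj₂ v the leaf attached to it.
corona : Graph (Fin n) → Graph (Fin n ⊎ Fin n)
corona {n} H = record
  { Adj    = A
  ; adj?   = A?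
  ; irrefl = λ { {inj₁ _} refl → irrefl H refl ; {inj₂ _} refl () }
  ; symm   = λ {u} {v} → A-sym u v
  }
  where
  A : Rel (Fin n ⊎ Fin n) 0ℓ
  A (inj₁ u) (inj₁ v) = Adj H u v
  A (inj₁ u) (inj₂ v) = u ≡ v
  A (inj₂ u) (inj₁ v) = u ≡ v
  A (inj₂ _) (inj₂ _) = ⊥

  A? : Decidable A
  A? (inj₁ u) (inj₁ v) = adj? H u v
  A? (inj₁ u) (inj₂ v) = u ≟ v
  A? (inj₂ u) (inj₁ v) = u ≟ v
  A? (inj₂ _) (inj₂ _) = no λ ()

  A-sym : ∀ u v → A u v → A v u
  A-sym (inj₁ _) (inj₁ _) = symm H
  A-sym (inj₁ _) (inj₂ _) = sym
  A-sym (inj₂ _) (inj₁ _) = sym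
  A-sym (inj₂ _) (inj₂ _) ()

infix 4 _≅_

record _≅_ (G : Graph V) (H : Graph W) : Set where
  field
    bijection : V ↔ W
    adjacency : ∀ u v →
      Adj G u v ⇔ Adj H (Inverse.to bijection u) (Inverse.to bijection v)

{-# OPTIONS --safe #-}

-- Call an independent set of order a full. Since a₂ = a + 2, no three pairwise
-- nonadjacent vertices lie outside a full set I. Extending {x} ∪ (I ∖ N(x)) to a
-- full set shows that every vertex x outside I has one or two neighbors in I,
-- and that if it has two, u and v, then some y outside I is not adjacent to x
-- and has its neighbors in I among u and v. Applying the triple condition to
-- (I ∖ {u, v}) ∪ {x, y} and to a vertex adjacent to a third element of I shows
-- that y has a single neighbor t in I, and that every vertex outside the full
-- set (I ∖ {t}) ∪ {y} has exactly one neighbor in it. For a full set with that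
-- property, the vertices outside form a clique and are matched with the set.
-- Conversely, in the corona of a complete graph a vertex set is k-colorable,
-- k ≥ 2, exactly when it has at most k vertices in the complete graph.
module Submission where

open import Defs
open import Data.Bool using (true)
open import Data.Empty using (⊥-elim)
open import Data.Fin using (Fin; zero; suc; _≟_; inject≤; join; splitAt)
open import Data.Fin.Properties
  using (any?; all?; injective⇒≤; inject≤-injective; join-splitAt; splitAt-join)
open import Data.Fin.Subset
  using (Subset; inside; outside; ⊥; ⊤; ⁅_⁆; ∁; _∈_; _∉_; _⊆_; _⊂_; _∪_; _-_; ∣_∣; Nonempty)
open import Data.Fin.Subset.Properties
open import Data.Nat using (ℕ; zero; suc; _+_; _≤_; _<_; z≤n; s≤s)
import Data.Nat.Properties as ℕ
open import Data.Product using (_×_; ∃; _,_; proj₁; proj₂)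
open import Data.Sum using (_⊎_; inj₁; inj₂; [_,_]′)
open import Data.Vec using (_∷_; []; _++_; here; there; lookup; tabulate)
open import Data.Vec.Properties
  using ([]=⇒lookup; lookup⇒[]=; lookup∘tabulate; tabulate∘lookup; tabulate-cong; lookup-splitAt)
open import Function using (_∘_; const)
open import Function.Bundles using (_⇔_; mk⇔; mk↔ₛ′; Inverse; Equivalence)
open import Relation.Binary.Construct.Closure.ReflexiveTransitive using (Star; ε; _◅_; _◅◅_; gmap)
open import Relation.Binary.PropositionalEquality
  using (_≡_; _≢_; refl; sym; trans; cong; cong₂; subst; subst₂; ≢-sym; module ≡-Reasoning)
open import Relation.Nullary using (¬_; Dec; yes; no; does; ¬?; contradiction)
open import Relation.Nullary.Decidable using (decidable-stable; _×-dec_; _→-dec_; dec-true)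
open import Relation.Unary using (Pred; Decidable)
open import Level using (0ℓ)

private
  variable
    m n : ℕ

-- Adding, deleting and counting elements of subsets of `Fin n`.

infixl 5 _⊕_

_⊕_ : Subset n → Fin n → Subset n
S ⊕ q = S ∪ ⁅ q ⁆

module _ {S : Subset n} {q : Fin n} where

  ∈⊕-old : ∀ {x} → x ∈ S → x ∈ S ⊕ q
  ∈⊕-old = p⊆p∪q ⁅ q ⁆

  ∈⊕-new : q ∈ S ⊕ q
  ∈⊕-new = q⊆p∪q S ⁅ q ⁆ (x∈⁅x⁆ q)

  ∈⊕⁻ : ∀ {x} → x ∈ S ⊕ q → x ≡ q ⊎ x ∈ S
  ∈⊕⁻ x∈ with x∈p∪q⁻ S ⁅ q ⁆ x∈
  ... | inj₁ x∈S = inj₂ x∈S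
  ... | inj₂ x∈q = inj₁ (x∈⁅y⁆⇒x≡y q x∈q)

∣S⊕q∣ : (S : Subset n) {q : Fin n} → q ∉ S → ∣ S ⊕ q ∣ ≡ suc ∣ S ∣
∣S⊕q∣ (outside ∷ S) {zero}  _  = cong (suc ∘ ∣_∣) (∪-identityʳ S)
∣S⊕q∣ (inside  ∷ S) {zero}  q∉ = contradiction here q∉
∣S⊕q∣ (outside ∷ S) {suc q} q∉ = ∣S⊕q∣ S (q∉ ∘ there)
∣S⊕q∣ (inside  ∷ S) {suc q} q∉ = cong suc (∣S⊕q∣ S (q∉ ∘ there))

∣S∣≡1+∣S-q∣ : (S : Subset n) {q : Fin n} → q ∈ S → ∣ S ∣ ≡ suc ∣ S - q ∣
∣S∣≡1+∣S-q∣ (inside  ∷ S) {zero}  here       = cong (suc ∘ ∣_∣) (sym (p─⊥≡p S))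
∣S∣≡1+∣S-q∣ (outside ∷ S) {suc q} (there q∈) = ∣S∣≡1+∣S-q∣ S q∈
∣S∣≡1+∣S-q∣ (inside  ∷ S) {suc q} (there q∈) = cong suc (∣S∣≡1+∣S-q∣ S q∈)

x∉S-x : (S : Subset n) {x : Fin n} → x ∉ S - x
x∉S-x (_ ∷ S) {suc x} (there x∈) = x∉S-x S x∈

∈-⁻ : ∀ {S : Subset n} {q x} → x ∈ S - q → x ∈ S × x ≢ q
∈-⁻ {S = S} {q} x∈ = p─q⊆p S ⁅ q ⁆ x∈ , λ { refl → x∉S-x S x∈ }

∣S∣>0⇒nonempty : (S : Subset n) → 0 < ∣ S ∣ → Nonempty S
∣S∣>0⇒nonempty {n} S 0<∣S∣ with nonempty? S
... | yes ne = ne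
... | no  ¬ne = contradiction 0<∣S∣
  (subst (λ s → ¬ 0 < s) (sym (trans (cong ∣_∣ (Empty-unique ¬ne)) (∣⊥∣≡0 n))) λ ())

module _ {P : Pred (Fin n) 0ℓ} (P? : Decidable P) where

  select : Subset n
  select = tabulate (does ∘ P?)

  ∈select⁺ : ∀ {x} → P x → x ∈ select
  ∈select⁺ {x} px = lookup⇒[]= x select (trans (lookup∘tabulate _ x) (dec-true (P? x) px))

  ∈select⁻ : ∀ {x} → x ∈ select → P x
  ∈select⁻ {x} x∈ with P? x | trans (sym (lookup∘tabulate (does ∘ P?) x)) ([]=⇒lookup x∈)
  ... | yes px | _ = px

-- Enumerating the elements of a subset.

rank : {S : Subset n} {x : Fin n} → x ∈ S → Fin ∣ S ∣
rank {S = inside  ∷ S} here       = zero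
rank {S = inside  ∷ S} (there x∈) = suc (rank x∈)
rank {S = outside ∷ S} (there x∈) = rank x∈

unrank : (S : Subset n) → Fin ∣ S ∣ → Fin n
unrank (inside  ∷ S) zero    = zero
unrank (inside  ∷ S) (suc i) = suc (unrank S i)
unrank (outside ∷ S) i       = suc (unrank S i)

unrank∈ : (S : Subset n) (i : Fin ∣ S ∣) → unrank S i ∈ S
unrank∈ (inside  ∷ S) zero    = here
unrank∈ (inside  ∷ S) (suc i) = there (unrank∈ S i)
unrank∈ (outside ∷ S) i       = there (unrank∈ S i)

rank-unrank : (S : Subset n) (i : Fin ∣ S ∣) → rank (unrank∈ S i) ≡ i
rank-unrank (inside  ∷ S) zero    = refl
rank-unrank (inside  ∷ S) (suc i) = cong suc (rank-unrank S i)
rank-unrank (outside ∷ S) i       = rank-unrank S i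

unrank-rank : {S : Subset n} {x : Fin n} (x∈ : x ∈ S) → unrank S (rank x∈) ≡ x
unrank-rank {S = inside  ∷ S} here       = refl
unrank-rank {S = inside  ∷ S} (there x∈) = cong suc (unrank-rank x∈)
unrank-rank {S = outside ∷ S} (there x∈) = cong suc (unrank-rank x∈)

-- `rank` is computed from a membership proof; this makes it depend on the element alone.
rank-cong : {S : Subset n} {x y : Fin n} (x∈ : x ∈ S) (y∈ : y ∈ S) → x ≡ y → rank x∈ ≡ rank y∈
rank-cong {S = inside  ∷ S} here       here       refl = refl
rank-cong {S = inside  ∷ S} (there x∈) (there y∈) refl = cong suc (rank-cong x∈ y∈ refl)
rank-cong {S = outside ∷ S} (there x∈) (there y∈) refl = rank-cong x∈ y∈ refl

rank-injective : {S : Subset n} {x y : Fin n} (x∈ : x ∈ S) (y∈ : y ∈ S) → rank x∈ ≡ rank y∈ → x ≡ y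
rank-injective {S = S} x∈ y∈ eq =
  trans (sym (unrank-rank x∈)) (trans (cong (unrank S) eq) (unrank-rank y∈))

unrank-injective : (S : Subset n) {i j : Fin ∣ S ∣} → unrank S i ≡ unrank S j → i ≡ j
unrank-injective S {i} {j} eq = trans (sym (rank-unrank S i))
  (trans (rank-cong (unrank∈ S i) (unrank∈ S j) eq) (rank-unrank S j))

-- Conjugating f with the enumerations of S and T gives an injection between the `Fin` types of
-- their orders.
∣∣-mono : (S : Subset m) (T : Subset n) (f : Fin m → Fin n) →
  (∀ {x y} → f x ≡ f y → x ≡ y) → (∀ {x} → x ∈ S → f x ∈ T) → ∣ S ∣ ≤ ∣ T ∣
∣∣-mono S T f f-inj f∈ = injective⇒≤ {f = λ i → rank (f∈ (unrank∈ S i))}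
  λ eq → unrank-injective S (f-inj (rank-injective (f∈ (unrank∈ S _)) (f∈ (unrank∈ S _)) eq))

∣++∣ : (S : Subset m) (T : Subset n) → ∣ S ++ T ∣ ≡ ∣ S ∣ + ∣ T ∣
∣++∣ []            T = refl
∣++∣ (inside  ∷ S) T = cong suc (∣++∣ S T)
∣++∣ (outside ∷ S) T = ∣++∣ S T

Fin1-unique : (i j : Fin 1) → i ≡ j
Fin1-unique zero zero = refl

¬three-in-Fin2 : (i j k : Fin 2) → i ≢ j → i ≢ k → ¬ j ≢ k
¬three-in-Fin2 zero       zero       _          p _ _ = p refl
¬three-in-Fin2 zero       (suc zero) zero       _ p _ = p refl
¬three-in-Fin2 zero       (suc zero) (suc zero) _ _ p = p refl
¬three-in-Fin2 (suc zero) zero       zero       _ _ p = p refl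
¬three-in-Fin2 (suc zero) zero       (suc zero) _ p _ = p refl
¬three-in-Fin2 (suc zero) (suc zero) _          p _ _ = p refl

-- Independent sets, colorability and the orders of colorable sets.

module Colorings {n : ℕ} (G : Graph (Fin n)) where

  infix 4 _~_

  _~_ : Fin n → Fin n → Set
  _~_ = Adj G

  ~⇒≢ : ∀ {x y} → x ~ y → x ≢ y
  ~⇒≢ x~y x≡y = irrefl G x≡y x~y

  Indep : Subset n → Set
  Indep S = ∀ {x y} → x ∈ S → y ∈ S → ¬ x ~ y

  indep-⊆ : ∀ {S T} → S ⊆ T → Indep T → Indep S
  indep-⊆ S⊆T indep x∈ y∈ = indep (S⊆T x∈) (S⊆T y∈)

  indep-⊕ : ∀ {S q} → Indep S → (∀ {x} → x ∈ S → ¬ q ~ x) → Indep (S ⊕ q)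
  indep-⊕ {S} {q} indep q≁ x∈ y∈ x~y with ∈⊕⁻ x∈ | ∈⊕⁻ y∈
  ... | inj₁ refl | inj₁ refl = ~⇒≢ x~y refl
  ... | inj₁ refl | inj₂ y∈S  = q≁ y∈S x~y
  ... | inj₂ x∈S  | inj₁ refl = q≁ x∈S (symm G x~y)
  ... | inj₂ x∈S  | inj₂ y∈S  = indep x∈S y∈S x~y

  indep-⁅⁆ : ∀ q → Indep ⁅ q ⁆
  indep-⁅⁆ q x∈ y∈ x~y = ~⇒≢ x~y (trans (x∈⁅y⁆⇒x≡y q x∈) (sym (x∈⁅y⁆⇒x≡y q y∈)))

  Col : ℕ → Subset n → Set
  Col k S = Colorable k (induced G S)

  col-⊆ : ∀ {k S T} → S ⊆ T → Col k T → Col k S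
  col-⊆ S⊆T (c , proper) =
    (λ { (v , v∈) → c (v , S⊆T v∈) }) , λ _ _ → proper _ _

  indep⇒col₁ : ∀ {S} → Indep S → Col 1 S
  indep⇒col₁ indep = (λ _ → zero) , λ { (_ , u∈) (_ , v∈) u~v _ → indep u∈ v∈ u~v }

  col₁⇒indep : ∀ {S} → Col 1 S → Indep S
  col₁⇒indep (c , proper) x∈ y∈ x~y = proper (_ , x∈) (_ , y∈) x~y (Fin1-unique _ _)

  two-indep⇒col₂ : ∀ {S P Q} → Indep P → Indep Q → (∀ {x} → x ∈ S → x ∈ P ⊎ x ∈ Q) → Col 2 S
  two-indep⇒col₂ {S} {P} {Q} indepP indepQ cover =
    (λ { (_ , x∈) → color (cover x∈) }) , λ { (_ , x∈) (_ , y∈) → proper (cover x∈) (cover y∈) }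
    where
    color : ∀ {x} → x ∈ P ⊎ x ∈ Q → Fin 2
    color = [ const zero , const (suc zero) ]′

    proper : ∀ {x y} (s : x ∈ P ⊎ x ∈ Q) (t : y ∈ P ⊎ y ∈ Q) → x ~ y → color s ≢ color t
    proper (inj₁ x∈) (inj₁ y∈) x~y _ = indepP x∈ y∈ x~y
    proper (inj₂ x∈) (inj₂ y∈) x~y _ = indepQ x∈ y∈ x~y

  col₂⇒¬triangle : ∀ {S x y z} → Col 2 S → x ∈ S → y ∈ S → z ∈ S →
    x ~ y → x ~ z → ¬ y ~ z
  col₂⇒¬triangle (c , proper) x∈ y∈ z∈ x~y x~z y~z = ¬three-in-Fin2
    (c (_ , x∈)) (c (_ , y∈)) (c (_ , z∈)) (proper _ _ x~y) (proper _ _ x~z) (proper _ _ y~z)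

  module Size (k s : ℕ) (size : ∀ S → MaximalColorable G k S → ∣ S ∣ ≡ s) where

    -- A colorable set of the wrong order is not maximal, and since colorability passes to subsets,
    -- a larger colorable set yields one with a single extra vertex. The conclusion is doubly
    -- negated because failure of maximality does not hand over that larger set.
    extend : ∀ {S} → Col k S → ∣ S ∣ ≢ s → ¬ (∀ {q} → q ∉ S → ¬ Col k (S ⊕ q))
    extend {S} col ≢s stuck = ≢s (size S (col , λ T (S⊆T , q , q∈T , q∉S) colT →
      stuck q∉S (col-⊆ (λ x∈ → [ (λ { refl → q∈T }) , S⊆T ]′ (∈⊕⁻ x∈)) colT)))

    -- A colorable set above order s could be enlarged again and again, as its order never returns
    -- to s, until it had more than n vertices.
    ∣col∣≤ : ∀ {S} → Col k S → ∣ S ∣ ≤ s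
    ∣col∣≤ {S} col = ℕ.≮⇒≥ λ s<∣S∣ → grow (suc n) S s<∣S∣ (s≤s (ℕ.m≤m+n n ∣ S ∣)) col
      where
      -- The counter j falls as ∣ S ∣ rises, so n < j + ∣ S ∣ persists; at j = 0 the set would have
      -- more than n vertices.
      grow : ∀ j S → s < ∣ S ∣ → n < j + ∣ S ∣ → ¬ Col k S
      grow zero    S _     n<  _   = ℕ.<⇒≱ n< (∣p∣≤n S)
      grow (suc j) S s<∣S∣ n< col = extend col (ℕ.>⇒≢ s<∣S∣) λ {q} q∉S →
        grow j (S ⊕ q) (subst (s <_) (sym (∣S⊕q∣ S q∉S)) (ℕ.m<n⇒m<1+n s<∣S∣))
          (subst (n <_) (sym (trans (cong (j +_) (∣S⊕q∣ S q∉S)) (ℕ.+-suc j ∣ S ∣))) n<)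

-- Full sets and the neighbors that outside vertices have in them.

module Forward {n : ℕ} (G : Graph (Fin n)) (a : ℕ) (3≤a : 3 ≤ a) (connected : Connected G)
  (size₁ : ∀ S → MaximalColorable G 1 S → ∣ S ∣ ≡ a)
  (size₂ : ∀ S → MaximalColorable G 2 S → ∣ S ∣ ≡ a + 2) where

  open Colorings G
  open Size 1 a size₁ using () renaming (extend to extend-col₁; ∣col∣≤ to ∣col₁∣≤)
  open Size 2 (a + 2) size₂ using () renaming (extend to extend-col₂; ∣col∣≤ to ∣col₂∣≤)

  ∣indep∣≤a : ∀ {S} → Indep S → ∣ S ∣ ≤ a
  ∣indep∣≤a indep = ∣col₁∣≤ (indep⇒col₁ indep)

  -- The condition on q is decidable, so a finite search turns the double negation of `extend-col₁`
  -- into a witness.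
  extend-indep : ∀ {S} → Indep S → ∣ S ∣ < a → ∃ λ q → q ∉ S × (∀ {x} → x ∈ S → ¬ q ~ x)
  extend-indep {S} indep <a
    with any? (λ q → ¬? (q ∈? S) ×-dec all? (λ x → (x ∈? S) →-dec ¬? (adj? G q x)))
  ... | yes (q , q∉S , q≁) = q , q∉S , q≁ _
  ... | no  ¬q = ⊥-elim (extend-col₁ (indep⇒col₁ indep) (ℕ.<⇒≢ <a) λ q∉S col →
    ¬q (_ , q∉S , λ x x∈S → col₁⇒indep col ∈⊕-new (∈⊕-old x∈S)))

  record MaxIndep (I : Subset n) : Set where
    field
      indep : Indep I
      size  : ∣ I ∣ ≡ a

  open MaxIndep

  -- With I and {x, y, z} as color classes, the union would be 2-colorable of order a + 3.
  no-triple : ∀ {I x y z} → MaxIndep I → x ∉ I → y ∉ I → z ∉ I →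
    x ≢ y → x ≢ z → y ≢ z → ¬ x ~ y → ¬ x ~ z → ¬ ¬ y ~ z
  no-triple {I} {x} {y} {z} max x∉ y∉ z∉ x≢y x≢z y≢z x≁y x≁z y≁z =
    ℕ.<⇒≱ too-big (∣col₂∣≤ (two-indep⇒col₂ (indep max) triple-indep cover))
    where
    y∉′ : y ∉ I ⊕ x
    y∉′ y∈ = [ ≢-sym x≢y , y∉ ]′ (∈⊕⁻ y∈)

    z∉′ : z ∉ I ⊕ x ⊕ y
    z∉′ z∈ = [ ≢-sym y≢z , [ ≢-sym x≢z , z∉ ]′ ∘ ∈⊕⁻ ]′ (∈⊕⁻ z∈)

    too-big : a + 2 < ∣ I ⊕ x ⊕ y ⊕ z ∣
    too-big = begin-strict
      a + 2               ≡⟨ ℕ.+-comm a 2 ⟩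
      2 + a               <⟨ ℕ.n<1+n _ ⟩
      3 + a               ≡⟨ cong (3 +_) (size max) ⟨
      3 + ∣ I ∣           ≡⟨ cong (2 +_) (∣S⊕q∣ I x∉) ⟨
      2 + ∣ I ⊕ x ∣       ≡⟨ cong suc (∣S⊕q∣ (I ⊕ x) y∉′) ⟨
      suc ∣ I ⊕ x ⊕ y ∣   ≡⟨ ∣S⊕q∣ (I ⊕ x ⊕ y) z∉′ ⟨
      ∣ I ⊕ x ⊕ y ⊕ z ∣   ∎
      where open ℕ.≤-Reasoning

    triple-indep : Indep (⁅ x ⁆ ⊕ y ⊕ z)
    triple-indep = indep-⊕
      (indep-⊕ (indep-⁅⁆ x) λ w∈ y~w → x≁y (symm G (subst (y ~_) (x∈⁅y⁆⇒x≡y x w∈) y~w)))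
      λ w∈ z~w → [ (λ { refl → y≁z (symm G z~w) })
                 , (λ w∈x → x≁z (symm G (subst (z ~_) (x∈⁅y⁆⇒x≡y x w∈x) z~w))) ]′ (∈⊕⁻ w∈)

    cover : ∀ {w} → w ∈ I ⊕ x ⊕ y ⊕ z → w ∈ I ⊎ w ∈ ⁅ x ⁆ ⊕ y ⊕ z
    cover w∈ with ∈⊕⁻ w∈
    ... | inj₁ refl = inj₂ ∈⊕-new
    ... | inj₂ w∈ with ∈⊕⁻ w∈
    ... | inj₁ refl = inj₂ (∈⊕-old ∈⊕-new)
    ... | inj₂ w∈ with ∈⊕⁻ w∈
    ... | inj₁ refl = inj₂ (∈⊕-old (∈⊕-old (x∈⁅x⁆ _)))
    ... | inj₂ w∈I  = inj₁ w∈I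

  -- Otherwise adding x to I would give an independent set of order a + 1.
  dominated : ∀ {I x} → MaxIndep I → x ∉ I → ∃ λ u → u ∈ I × x ~ u
  dominated {I} {x} max x∉ with any? (λ u → (u ∈? I) ×-dec adj? G x u)
  ... | yes nbr = nbr
  ... | no ¬nbr = contradiction
    (∣indep∣≤a (indep-⊕ (indep max) λ u∈ x~u → ¬nbr (_ , u∈ , x~u)))
    (subst (λ s → ¬ s ≤ a) (sym (trans (∣S⊕q∣ I x∉) (cong suc (size max)))) ℕ.1+n≰n)

  -- Once S contains x and I ∖ N(x), an independent extension of S can only use
  -- vertices outside I whose neighbors in I are neighbors of x.
  escape : ∀ {I x S} → MaxIndep I → Indep S → ∣ S ∣ < a →
    x ∈ S → (∀ {w} → w ∈ I → ¬ x ~ w → w ∈ S) →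
    ∃ λ y → y ∉ S × y ∉ I × (∀ {w} → w ∈ S → ¬ y ~ w) × (∀ {w} → w ∈ I → y ~ w → x ~ w)
  escape {I} {x} {S} max indepS <a x∈S rest∈S with extend-indep indepS <a
  ... | y , y∉S , y≁S =
    -- Were y in I, its nonadjacency to x would already have put it in S.
    y , y∉S , (λ y∈I → y∉S (rest∈S y∈I (y≁S x∈S ∘ symm G))) , y≁S ,
    λ {w} w∈I y~w → decidable-stable (adj? G x w) λ x≁w → y≁S (rest∈S w∈I x≁w) y~w

  residual? : ∀ I x → Decidable (λ w → w ∈ I × ¬ x ~ w)
  residual? I x w = (w ∈? I) ×-dec ¬? (adj? G x w)

  residual : Subset n → Fin n → Subset n
  residual I x = select (residual? I x) ⊕ x

  ∈residual : ∀ {I x w} → w ∈ I → ¬ x ~ w → w ∈ residual I x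
  ∈residual w∈I x≁w = ∈⊕-old (∈select⁺ (residual? _ _) (w∈I , x≁w))

  residual-indep : ∀ {I x} → MaxIndep I → Indep (residual I x)
  residual-indep max = indep-⊕
    (indep-⊆ (proj₁ ∘ ∈select⁻ (residual? _ _)) (indep max))
    (proj₂ ∘ ∈select⁻ (residual? _ _))

  ∣I∣≡2+ : ∀ {I : Subset n} {u v} → u ∈ I → v ∈ I → u ≢ v → ∣ I ∣ ≡ 2 + ∣ I - u - v ∣
  ∣I∣≡2+ {I} {u} u∈ v∈ u≢v = trans (∣S∣≡1+∣S-q∣ I u∈)
    (cong suc (∣S∣≡1+∣S-q∣ (I - u) (x∈p∧x≢y⇒x∈p-y v∈ (≢-sym u≢v))))

  -- Passing from I to the residual set loses at least u and v and gains only x.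
  ∣residual∣<a : ∀ {I x u v} → MaxIndep I → x ∉ I → u ∈ I → v ∈ I → u ≢ v →
    x ~ u → x ~ v → ∣ residual I x ∣ < a
  ∣residual∣<a {I} {x} {u} {v} max x∉ u∈ v∈ u≢v x~u x~v =
    subst (suc ∣ residual I x ∣ ≤_)
      (trans (cong suc (∣S⊕q∣ (I - u - v) (x∉ ∘ proj₁ ∘ ∈-⁻ ∘ proj₁ ∘ ∈-⁻)))
        (trans (sym (∣I∣≡2+ u∈ v∈ u≢v)) (size max)))
      (s≤s (p⊆q⇒∣p∣≤∣q∣ {p = residual I x} {q = I - u - v ⊕ x} λ w∈ →
        [ (λ { refl → ∈⊕-new }) , inside-I ]′ (∈⊕⁻ w∈)))
    where
    inside-I : ∀ {w} → w ∈ select (residual? I x) → w ∈ I - u - v ⊕ x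
    inside-I w∈ with ∈select⁻ (residual? I x) w∈
    ... | w∈I , x≁w = ∈⊕-old (x∈p∧x≢y⇒x∈p-y (x∈p∧x≢y⇒x∈p-y w∈I λ { refl → x≁w x~u }) λ { refl → x≁w x~v })

  -- With three neighbors of x removed from I, the residual set has order at most a - 2 and can be
  -- extended twice, by y and then z. Both lie outside I, and x, y, z contradict `no-triple`.
  at-most-two : ∀ {I x u v w} → MaxIndep I → x ∉ I → u ∈ I → v ∈ I → w ∈ I → u ≢ v →
    x ~ u → x ~ v → x ~ w → w ≡ u ⊎ w ≡ v
  at-most-two {I} {x} {u} {v} {w} max x∉ u∈ v∈ w∈ u≢v x~u x~v x~w with w ≟ u | w ≟ v
  ... | yes w≡u | _       = inj₁ w≡u
  ... | no  _   | yes w≡v = inj₂ w≡v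
  ... | no  w≢u | no  w≢v
    with escape max (residual-indep max) (∣residual∣<a max x∉ u∈ v∈ u≢v x~u x~v) ∈⊕-new ∈residual
  ... | y , y∉R , y∉ , y≁R , _
    with escape max (indep-⊕ (residual-indep max) y≁R) small (∈⊕-old ∈⊕-new) (λ w∈ → ∈⊕-old ∘ ∈residual w∈)
    where
    open ℕ.≤-Reasoning

    R⊕y⊆ : residual I x ⊕ y ⊆ I - u - v - w ⊕ x ⊕ y
    R⊕y⊆ z∈ with ∈⊕⁻ z∈
    ... | inj₁ refl = ∈⊕-new
    ... | inj₂ z∈ with ∈⊕⁻ z∈
    ... | inj₁ refl = ∈⊕-old ∈⊕-new
    ... | inj₂ z∈ with ∈select⁻ (residual? I x) z∈
    ... | z∈I , x≁z = ∈⊕-old (∈⊕-old (x∈p∧x≢y⇒x∈p-y (x∈p∧x≢y⇒x∈p-y (x∈p∧x≢y⇒x∈p-y z∈I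
      λ { refl → x≁z x~u }) λ { refl → x≁z x~v }) λ { refl → x≁z x~w }))

    R : Subset n
    R = I - u - v - w

    x∉R : x ∉ R
    x∉R = x∉ ∘ proj₁ ∘ ∈-⁻ ∘ proj₁ ∘ ∈-⁻ ∘ proj₁ ∘ ∈-⁻

    y∉R⊕x : y ∉ R ⊕ x
    y∉R⊕x y∈ with ∈⊕⁻ y∈
    ... | inj₁ refl = y∉R ∈⊕-new
    ... | inj₂ y∈   = y∉ (proj₁ (∈-⁻ (proj₁ (∈-⁻ (proj₁ (∈-⁻ y∈))))))

    small : ∣ residual I x ⊕ y ∣ < a
    small = begin-strict
      ∣ residual I x ⊕ y ∣ ≤⟨ p⊆q⇒∣p∣≤∣q∣ R⊕y⊆ ⟩
      ∣ R ⊕ x ⊕ y ∣        ≡⟨ ∣S⊕q∣ (R ⊕ x) y∉R⊕x ⟩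
      suc ∣ R ⊕ x ∣        ≡⟨ cong suc (∣S⊕q∣ R x∉R) ⟩
      2 + ∣ R ∣            <⟨ ℕ.n<1+n _ ⟩
      3 + ∣ R ∣            ≡⟨ cong (2 +_) (∣S∣≡1+∣S-q∣ (I - u - v) (x∈p∧x≢y⇒x∈p-y (x∈p∧x≢y⇒x∈p-y w∈ w≢u) w≢v)) ⟨
      2 + ∣ I - u - v ∣    ≡⟨ ∣I∣≡2+ u∈ v∈ u≢v ⟨
      ∣ I ∣                ≡⟨ size max ⟩
      a                    ∎
  ... | z , z∉ , z∉I , z≁ , _ = ⊥-elim (no-triple max x∉ y∉ z∉I
    (λ { refl → y∉R ∈⊕-new }) (λ { refl → z∉ (∈⊕-old ∈⊕-new) }) (λ { refl → z∉ ∈⊕-new })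
    (y≁R ∈⊕-new ∘ symm G) (z≁ (∈⊕-old ∈⊕-new) ∘ symm G) (z≁ ∈⊕-new ∘ symm G))

  -- Removing u and v and adding x leaves room for one more vertex. `escape` places it outside I and
  -- confines its neighbors in I to those of x.
  partner : ∀ {I x u v} → MaxIndep I → x ∉ I → u ∈ I → v ∈ I → u ≢ v → x ~ u → x ~ v →
    ∃ λ y → y ∉ I × y ≢ x × ¬ x ~ y × (∀ {w} → w ∈ I → y ~ w → x ~ w)
  partner max x∉ u∈ v∈ u≢v x~u x~v
    with escape max (residual-indep max) (∣residual∣<a max x∉ u∈ v∈ u≢v x~u x~v) ∈⊕-new ∈residual
  ... | y , y∉R , y∉ , y≁R , N⊆ =
    y , y∉ , (λ { refl → y∉R ∈⊕-new }) , y≁R ∈⊕-new ∘ symm G , N⊆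

  -- Outside vertices with two neighbors in a full set.

  record Square (I : Subset n) (u v x y : Fin n) : Set where
    field
      max   : MaxIndep I
      u∈    : u ∈ I
      v∈    : v ∈ I
      u≢v   : u ≢ v
      x∉    : x ∉ I
      y∉    : y ∉ I
      y≢x   : y ≢ x
      x~u   : x ~ u
      x~v   : x ~ v
      x≁y   : ¬ x ~ y
      -- If y is adjacent to both u and v, then u, x, v, y is an induced 4-cycle; in general y may
      -- see just one of the two.
      Ny⊆Nx : ∀ {w} → w ∈ I → y ~ w → x ~ w

    Nx : ∀ {w} → w ∈ I → x ~ w → w ≡ u ⊎ w ≡ v
    Nx w∈ = at-most-two max x∉ u∈ v∈ w∈ u≢v x~u x~v

    flip : Square I v u x y
    flip = record
      { max = max ; u∈ = v∈ ; v∈ = u∈ ; u≢v = ≢-sym u≢v ; x∉ = x∉ ; y∉ = y∉ ; y≢x = y≢x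
      ; x~u = x~v ; x~v = x~u ; x≁y = x≁y ; Ny⊆Nx = Ny⊆Nx }

    exchanged : Subset n
    exchanged = I - u - v ⊕ x ⊕ y

    ∈exchanged⁻ : ∀ {w} → w ∈ exchanged → w ≡ y ⊎ w ≡ x ⊎ (w ∈ I × w ≢ u × w ≢ v)
    ∈exchanged⁻ w∈ with ∈⊕⁻ w∈
    ... | inj₁ w≡y = inj₁ w≡y
    ... | inj₂ w∈ with ∈⊕⁻ w∈
    ... | inj₁ w≡x = inj₂ (inj₁ w≡x)
    ... | inj₂ w∈ with ∈-⁻ w∈
    ... | w∈ , w≢v = inj₂ (inj₂ (proj₁ (∈-⁻ w∈) , proj₂ (∈-⁻ w∈) , w≢v))

    x≁kept : ∀ {w} → w ∈ I → w ≢ u → w ≢ v → ¬ x ~ w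
    x≁kept w∈ w≢u w≢v x~w = [ w≢u , w≢v ]′ (Nx w∈ x~w)

    -- Two vertices leave and two enter. What remains of I avoids the neighbors of x, hence also
    -- those of y.
    exchanged-max : MaxIndep exchanged
    exchanged-max .indep = indep-⊕
      (indep-⊕ (indep-⊆ (proj₁ ∘ ∈-⁻ ∘ proj₁ ∘ ∈-⁻) (indep max))
        λ w∈ → let w∈′ , w≢v = ∈-⁻ w∈ ; w∈I , w≢u = ∈-⁻ w∈′ in x≁kept w∈I w≢u w≢v)
      λ w∈ y~w → [ (λ { refl → x≁y (symm G y~w) })
                 , (λ w∈ → let w∈′ , w≢v = ∈-⁻ w∈ ; w∈I , w≢u = ∈-⁻ w∈′ in
                           x≁kept w∈I w≢u w≢v (Ny⊆Nx w∈I y~w)) ]′ (∈⊕⁻ w∈)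
    exchanged-max .size = begin
      ∣ I - u - v ⊕ x ⊕ y ∣  ≡⟨ ∣S⊕q∣ (I - u - v ⊕ x)
        (λ y∈ → [ y≢x , y∉ ∘ proj₁ ∘ ∈-⁻ ∘ proj₁ ∘ ∈-⁻ ]′ (∈⊕⁻ y∈)) ⟩
      suc ∣ I - u - v ⊕ x ∣  ≡⟨ cong suc (∣S⊕q∣ (I - u - v) (x∉ ∘ proj₁ ∘ ∈-⁻ ∘ proj₁ ∘ ∈-⁻)) ⟩
      2 + ∣ I - u - v ∣      ≡⟨ ∣I∣≡2+ u∈ v∈ u≢v ⟨
      ∣ I ∣                  ≡⟨ size max ⟩
      a                      ∎
      where open ≡-Reasoning

    u∉exchanged : u ∉ exchanged
    u∉exchanged u∈′ with ∈exchanged⁻ u∈′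
    ... | inj₁ refl                   = y∉ u∈
    ... | inj₂ (inj₁ refl)            = x∉ u∈
    ... | inj₂ (inj₂ (_ , u≢u , _))   = u≢u refl

    v∉exchanged : v ∉ exchanged
    v∉exchanged v∈′ with ∈exchanged⁻ v∈′
    ... | inj₁ refl                   = y∉ v∈
    ... | inj₂ (inj₁ refl)            = x∉ v∈
    ... | inj₂ (inj₂ (_ , _ , v≢v))   = v≢v refl

    module _ {w z} (w∈ : w ∈ I) (w≢u : w ≢ u) (w≢v : w ≢ v) (z~w : z ~ w) where

      z∉ : z ∉ I
      z∉ z∈ = indep max z∈ w∈ z~w

      -- The neighbors of x and y in I are among u and v, so a vertex adjacent to w is neither x nor
      -- y.
      z∉exchanged : z ∉ exchanged
      z∉exchanged z∈ with ∈exchanged⁻ z∈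
      ... | inj₁ refl                  = x≁kept w∈ w≢u w≢v (Ny⊆Nx w∈ z~w)
      ... | inj₂ (inj₁ refl)           = x≁kept w∈ w≢u w≢v z~w
      ... | inj₂ (inj₂ (z∈I , _))      = z∉ z∈I

  open Square using (flip)

  square : ∀ {I x u v} → MaxIndep I → x ∉ I → u ∈ I → v ∈ I → u ≢ v → x ~ u → x ~ v →
    ∃ (Square I u v x)
  square max x∉ u∈ v∈ u≢v x~u x~v with partner max x∉ u∈ v∈ u≢v x~u x~v
  ... | y , y∉ , y≢x , x≁y , N⊆ = y , record
    { max = max ; u∈ = u∈ ; v∈ = v∈ ; u≢v = u≢v ; x∉ = x∉ ; y∉ = y∉ ; y≢x = y≢x
    ; x~u = x~u ; x~v = x~v ; x≁y = x≁y ; Ny⊆Nx = N⊆ }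

  module _ {I u v x y} (sq : Square I u v x y) where

    open Square sq hiding (flip)

    -- Otherwise z, u, v would be a triple outside (I ∖ {u, v}) ∪ {x, y}.
    square-neighbor : ∀ {w z} → w ∈ I → w ≢ u → w ≢ v → z ~ w → z ~ u ⊎ z ~ v
    square-neighbor {w} {z} w∈ w≢u w≢v z~w with adj? G z u | adj? G z v
    ... | yes z~u | _       = inj₁ z~u
    ... | no  _   | yes z~v = inj₂ z~v
    ... | no  z≁u | no  z≁v = ⊥-elim (no-triple (exchanged-max)
      (z∉exchanged w∈ w≢u w≢v z~w) u∉exchanged v∉exchanged
      (λ { refl → z∉ w∈ w≢u w≢v z~w u∈ }) (λ { refl → z∉ w∈ w≢u w≢v z~w v∈ }) u≢v
      z≁u z≁v (indep max u∈ v∈))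

    -- Being adjacent to w, u and v at once would contradict `at-most-two`.
    square-≁ : ∀ {w z} → w ∈ I → w ≢ u → w ≢ v → z ~ w → z ~ u → ¬ z ~ v
    square-≁ w∈ w≢u w≢v z~w z~u z~v = [ ≢-sym w≢v , ≢-sym u≢v ]′
      (at-most-two max (z∉ w∈ w≢u w≢v z~w) w∈ u∈ v∈ w≢u z~w z~u z~v)

    -- The partner of z must be y: otherwise it would form, with z and v, a
    -- triple outside (I ∖ {u, v}) ∪ {x, y}.
    square-pinned : ∀ {w z} → w ∈ I → w ≢ u → w ≢ v → z ~ w → z ~ u →
      y ~ u × ¬ y ~ v × ¬ z ~ y × ¬ z ~ v
    square-pinned {w} {z} w∈ w≢u w≢v z~w z~u
      with partner max (z∉ w∈ w≢u w≢v z~w) w∈ u∈ w≢u z~w z~u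
       | square-≁ w∈ w≢u w≢v z~w z~u
    ... | z′ , z′∉ , z′≢z , z≁z′ , N⊆ | z≁v with z′ ≟ y
    -- As the partner of z, y has no neighbors in I beyond those of z, so it misses v; since it is
    -- dominated from within {u, v}, it is adjacent to u.
    ... | yes refl = y~u , (λ y~v → z≁v (N⊆ v∈ y~v)) , z≁z′ , z≁v
      where
      y~u : y ~ u
      y~u with dominated max y∉
      ... | t , t∈ , y~t with Nx t∈ (Ny⊆Nx t∈ y~t)
      ... | inj₁ refl = y~t
      ... | inj₂ refl = ⊥-elim (z≁v (N⊆ t∈ y~t))
    ... | no z′≢y = ⊥-elim (no-triple exchanged-max
      (z∉exchanged w∈ w≢u w≢v z~w) z′∉exchanged v∉exchanged (≢-sym z′≢z)
      (λ { refl → z∉ w∈ w≢u w≢v z~w v∈ }) (λ { refl → z′∉ v∈ }) z≁z′ z≁v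
      (λ z′~v → z≁v (N⊆ v∈ z′~v)))
      where
      z′∉exchanged : z′ ∉ exchanged
      z′∉exchanged z′∈ with ∈exchanged⁻ z′∈
      ... | inj₁ z′≡y              = z′≢y z′≡y
      -- If z′ were x, its neighbor v would have to be a neighbor of z.
      ... | inj₂ (inj₁ refl)       = z≁v (N⊆ v∈ x~v)
      ... | inj₂ (inj₂ (z′∈I , _)) = z′∉ z′∈I

  -- Reaching a full set in which every outside vertex has one neighbor.

  swapped : Subset n → Fin n → Fin n → Subset n
  swapped I u x = I - u ⊕ x

  swapped-max : ∀ {I u x} → MaxIndep I → u ∈ I → x ∉ I → (∀ {w} → w ∈ I → x ~ w → w ≡ u) →
    MaxIndep (swapped I u x)
  swapped-max max u∈ x∉ Nx .indep = indep-⊕ (indep-⊆ (proj₁ ∘ ∈-⁻) (indep max))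
    λ w∈ x~w → proj₂ (∈-⁻ w∈) (Nx (proj₁ (∈-⁻ w∈)) x~w)
  swapped-max {I} {u} max u∈ x∉ Nx .size = trans (∣S⊕q∣ (I - u) (x∉ ∘ proj₁ ∘ ∈-⁻))
    (trans (sym (∣S∣≡1+∣S-q∣ I u∈)) (size max))

  -- Deleting two elements from I leaves something because a ≥ 3.
  third : ∀ {I u v} → MaxIndep I → u ∈ I → v ∈ I → u ≢ v → ∃ λ w → w ∈ I × w ≢ u × w ≢ v
  third {I} {u} {v} max u∈ v∈ u≢v with ∣S∣>0⇒nonempty (I - u - v) (ℕ.+-cancelˡ-≤ 2 1 _
    (subst (3 ≤_) (trans (sym (size max)) (∣I∣≡2+ u∈ v∈ u≢v)) 3≤a))
  ... | w , w∈ = w , proj₁ (∈-⁻ (proj₁ (∈-⁻ w∈))) , proj₂ (∈-⁻ (proj₁ (∈-⁻ w∈))) , proj₂ (∈-⁻ w∈)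

  -- The first edge of a path from u to v.
  neighbor : ∀ {u v} → u ≢ v → ∃ λ z → z ~ u
  neighbor {u} {v} u≢v with connected u v
  ... | ε       = contradiction refl u≢v
  ... | u~z ◅ _ = _ , symm G u~z

  -- The elements of I will be the leaves of the corona: together with `dominated`, `unique` gives
  -- each outside vertex exactly one neighbor in I.
  record Pendant (I : Subset n) : Set where
    field
      max     : MaxIndep I
      unique  : ∀ {p b c} → p ∉ I → b ∈ I → c ∈ I → p ~ b → p ~ c → b ≡ c

  -- A neighbor z of a third element w is adjacent to u or v. By the symmetry `flip`, call that one
  -- t and the other s; exchanging t for y produces the required set.
  square⇒pendant : ∀ {I u v x y} → Square I u v x y → ∃ Pendant
  square⇒pendant {I} {u} {v} sq with third max u∈ v∈ u≢v
    where open Square sq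
  ... | w , w∈ , w≢u , w≢v with neighbor w≢u
  ... | z , z~w = [ swap-out sq w∈ w≢u w≢v z~w , swap-out (flip sq) w∈ w≢v w≢u z~w ]′
                  (square-neighbor sq w∈ w≢u w≢v z~w)
    where
    swap-out : ∀ {t s x y} → Square I t s x y → ∀ {w z} → w ∈ I → w ≢ t → w ≢ s →
      z ~ w → z ~ t → ∃ Pendant
    swap-out {t} {s} {x} {y} sq {w} {z} w∈ w≢t w≢s z~w z~t = J , record { max = maxJ ; unique = unique }
      where
      open Square sq hiding (flip)

      J : Subset n
      J = swapped I t y

      y-facts : y ~ t × ¬ y ~ s × ¬ z ~ y × ¬ z ~ s
      y-facts = square-pinned sq w∈ w≢t w≢s z~w z~t

      y≁s : ¬ y ~ s
      y≁s = proj₁ (proj₂ y-facts)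

      Ny : ∀ {r} → r ∈ I → y ~ r → r ≡ t
      Ny r∈ y~r with Nx r∈ (Ny⊆Nx r∈ y~r)
      ... | inj₁ r≡t  = r≡t
      ... | inj₂ refl = contradiction y~r y≁s

      maxJ : MaxIndep J
      maxJ = swapped-max max u∈ y∉ Ny

      ∈J : ∀ {r} → r ∈ I → r ≢ t → r ∈ J
      ∈J r∈ r≢t = ∈⊕-old (x∈p∧x≢y⇒x∈p-y r∈ r≢t)

      J⁻ : ∀ {r} → r ∈ J → r ≡ y ⊎ (r ∈ I × r ≢ t)
      J⁻ r∈ = [ inj₁ , inj₂ ∘ ∈-⁻ ]′ (∈⊕⁻ r∈)

      -- Adjacency of p to s is impossible, since `square-pinned` on the flipped square would make y
      -- adjacent to s.
      pinned : ∀ {r p} → r ∈ I → r ≢ t → r ≢ s → p ~ r → p ~ t × ¬ p ~ y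
      pinned r∈ r≢t r≢s p~r with square-neighbor sq r∈ r≢t r≢s p~r
      ... | inj₁ p~t = p~t , proj₁ (proj₂ (proj₂ (square-pinned sq r∈ r≢t r≢s p~r p~t)))
      ... | inj₂ p~s = contradiction (proj₁ (square-pinned (flip sq) r∈ r≢s r≢t p~r p~s)) y≁s

      -- The neighbors of p in I are just r and t, and p misses y; exchanging t for y therefore
      -- leaves r alone.
      far : ∀ {p r c} → r ∈ I → r ≢ t → r ≢ s → p ~ r → c ∈ J → p ~ c → r ≡ c
      far {p} {r} {c} r∈ r≢t r≢s p~r c∈ p~c with J⁻ c∈ | pinned r∈ r≢t r≢s p~r
      ... | inj₁ refl       | _   , p≁y = contradiction p~c p≁y
      ... | inj₂ (c∈ , c≢t) | p~t , _   with at-most-two max (λ p∈ → indep max p∈ r∈ p~r)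
                                             r∈ u∈ c∈ r≢t p~r p~t p~c
      ... | inj₁ c≡r = sym c≡r
      ... | inj₂ c≡t = contradiction c≡t c≢t

      -- Such a p would span a new square over J with y and s as its feet. Then z, adjacent to the
      -- third element w, would be adjacent to y or s, and it is adjacent to neither.
      near : ∀ {p} → p ∉ J → p ~ y → ¬ p ~ s
      near p∉ p~y p~s with square maxJ p∉ ∈⊕-new (∈J v∈ (≢-sym u≢v)) (λ { refl → y∉ v∈ }) p~y p~s
      ... | _ , sq′ = [ proj₁ (proj₂ (proj₂ y-facts)) , proj₂ (proj₂ (proj₂ y-facts)) ]′
        (square-neighbor sq′ (∈J w∈ w≢t) (λ { refl → y∉ w∈ }) w≢s z~w)

      -- A neighbor in J other than y and s is the only one by `far`; y and s together are excluded
      -- by `near`.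
      unique : ∀ {p b c} → p ∉ J → b ∈ J → c ∈ J → p ~ b → p ~ c → b ≡ c
      unique {p} {b} {c} p∉ b∈ c∈ p~b p~c with J⁻ b∈ | J⁻ c∈
      ... | inj₁ refl        | inj₁ refl        = refl
      ... | inj₁ refl        | inj₂ (c∈I , c≢t) with c ≟ s
      ...   | yes refl = contradiction p~c (near p∉ p~b)
      ...   | no c≢s   = sym (far c∈I c≢t c≢s p~c b∈ p~b)
      unique {p} {b} {c} p∉ b∈ c∈ p~b p~c | inj₂ (b∈I , b≢t) | _ with b ≟ s
      ...   | no b≢s   = far b∈I b≢t b≢s p~b c∈ p~c
      ...   | yes refl with J⁻ c∈
      ...     | inj₁ refl = contradiction p~b (near p∉ p~c)
      ...     | inj₂ (c∈I , c≢t) with c ≟ s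
      ...       | yes refl = refl
      ...       | no c≢s   = sym (far c∈I c≢t c≢s p~c b∈ p~b)

  pendant : ∀ {I} → MaxIndep I → ∃ Pendant
  pendant {I} max with any? (λ p → ¬? (p ∈? I) ×-dec any? (λ b → any? (λ c →
    (b ∈? I) ×-dec (c ∈? I) ×-dec ¬? (b ≟ c) ×-dec adj? G p b ×-dec adj? G p c)))
  ... | yes (p , p∉ , b , c , b∈ , c∈ , b≢c , p~b , p~c) =
    square⇒pendant (proj₂ (square max p∉ b∈ c∈ b≢c p~b p~c))
  ... | no none = I , record { max = max ; unique = λ {_} {b} {c} p∉ b∈ c∈ p~b p~c →
    decidable-stable (b ≟ c) λ b≢c → none (_ , p∉ , b , c , b∈ , c∈ , b≢c , p~b , p~c) }

  -- The vertices outside a pendant full set form a clique matched with it.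

  module Recognition {I : Subset n} (pendant : Pendant I) where

    open Pendant pendant

    outside-swap : ∀ {v x} → v ∈ I → x ∉ I → x ~ v → MaxIndep (swapped I v x)
    outside-swap v∈ x∉ x~v = swapped-max max v∈ x∉ λ w∈ x~w → unique x∉ w∈ v∈ x~w x~v

    module _ {v x y : Fin n} (v∈ : v ∈ I) (x∉ : x ∉ I) (y∉ : y ∉ I)
      (x~v : x ~ v) (y~v : y ~ v) (x≢y : x ≢ y) where

      private
        S : Subset n
        S = swapped I v x ⊕ y

      ∣S∣ : ∣ S ∣ ≡ suc a
      ∣S∣ = trans (∣S⊕q∣ (swapped I v x) λ y∈ → [ ≢-sym x≢y , y∉ ∘ proj₁ ∘ ∈-⁻ ]′ (∈⊕⁻ y∈))
        (cong suc (size (outside-swap v∈ x∉ x~v)))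

      -- Otherwise exchanging v for both x and y would give an independent set of order a + 1.
      same-foot⇒~ : x ~ y
      same-foot⇒~ = decidable-stable (adj? G x y) λ x≁y → contradiction
        (∣indep∣≤a {S} (indep-⊕ (indep (outside-swap v∈ x∉ x~v)) λ w∈ y~w → [ (λ { refl → x≁y (symm G y~w) })
          , (λ w∈ → proj₂ (∈-⁻ w∈) (unique y∉ (proj₁ (∈-⁻ w∈)) v∈ y~w y~v)) ]′ (∈⊕⁻ w∈)))
        (subst (λ s → ¬ s ≤ a) (sym ∣S∣) ℕ.1+n≰n)

      same-foot-col₂ : Col 2 S
      same-foot-col₂ = two-indep⇒col₂ (indep (outside-swap v∈ x∉ x~v)) (indep-⁅⁆ y)
        λ w∈ → [ (λ { refl → inj₂ (x∈⁅x⁆ y) }) , inj₁ ]′ (∈⊕⁻ w∈)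

      same-foot-∉ : ∀ {q} → q ∉ S → (q ≡ v) ⊎ (q ∉ I × q ≢ x × q ≢ y)
      same-foot-∉ {q} q∉ with q ≟ v | q ∈? I
      ... | yes q≡v | _      = inj₁ q≡v
      ... | no  q≢v | yes q∈ = contradiction (∈⊕-old (∈⊕-old (x∈p∧x≢y⇒x∈p-y q∈ q≢v))) q∉
      ... | no  _   | no q∉I = inj₂ (q∉I , (λ { refl → q∉ (∈⊕-old ∈⊕-new) }) , λ { refl → q∉ ∈⊕-new })

    -- Exchange a third element w for a neighbor z of it. If x and y were nonadjacent, then x, y, w
    -- would be a triple outside the new full set, as w is the foot of neither.
    distinct-feet⇒~ : ∀ {x y u v} → x ∉ I → y ∉ I → u ∈ I → v ∈ I → u ≢ v → x ~ u → y ~ v → x ~ y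
    distinct-feet⇒~ {x} {y} {u} {v} x∉ y∉ u∈ v∈ u≢v x~u y~v with third max u∈ v∈ u≢v
    ... | w , w∈ , w≢u , w≢v with neighbor w≢u
    ... | z , z~w = decidable-stable (adj? G x y) λ x≁y → no-triple
      (outside-swap w∈ z∉ z~w)
      (λ x∈ → [ (λ { refl → w≢u (unique x∉ w∈ u∈ z~w x~u) }) , x∉ ∘ proj₁ ∘ ∈-⁻ ]′ (∈⊕⁻ x∈))
      (λ y∈ → [ (λ { refl → w≢v (unique y∉ w∈ v∈ z~w y~v) }) , y∉ ∘ proj₁ ∘ ∈-⁻ ]′ (∈⊕⁻ y∈))
      (λ w∈′ → [ (λ { refl → z∉ w∈ }) , (λ w∈ → proj₂ (∈-⁻ w∈) refl) ]′ (∈⊕⁻ w∈′))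
      (λ { refl → u≢v (unique x∉ u∈ v∈ x~u y~v) }) (λ { refl → x∉ w∈ }) (λ { refl → y∉ w∈ })
      x≁y (λ x~w → w≢u (unique x∉ w∈ u∈ x~w x~u)) (λ y~w → w≢v (unique y∉ w∈ v∈ y~w y~v))
      where
      z∉ : z ∉ I
      z∉ z∈ = indep max z∈ w∈ z~w

    outside⇒~ : ∀ {x y} → x ∉ I → y ∉ I → x ≢ y → x ~ y
    outside⇒~ x∉ y∉ x≢y with dominated max x∉ | dominated max y∉
    ... | u , u∈ , x~u | v , v∈ , y~v with u ≟ v
    ... | yes refl = same-foot⇒~ u∈ x∉ y∉ x~u y~v x≢y
    ... | no  u≢v  = distinct-feet⇒~ x∉ y∉ u∈ v∈ u≢v x~u y~v

    -- (I ∖ {v}) ∪ {x, y} is 2-colorable, but any further vertex closes a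
    -- triangle with x and y, so its order a + 1 would have to be a + 2.
    same-foot⇒≡ : ∀ {v x y} → v ∈ I → x ∉ I → y ∉ I → x ~ v → y ~ v → x ≡ y
    same-foot⇒≡ {v} {x} {y} v∈ x∉ y∉ x~v y~v = decidable-stable (x ≟ y) λ x≢y →
      extend-col₂ (same-foot-col₂ v∈ x∉ y∉ x~v y~v x≢y)
        (λ eq → ℕ.<⇒≢ (ℕ.n<1+n (suc a))
          (trans (sym (∣S∣ v∈ x∉ y∉ x~v y~v x≢y)) (trans eq (ℕ.+-comm a 2))))
        λ q∉ col → closes x≢y col (same-foot-∉ v∈ x∉ y∉ x~v y~v x≢y q∉)
      where
      closes : x ≢ y → ∀ {q} → Col 2 (swapped I v x ⊕ y ⊕ q) → ¬ (q ≡ v ⊎ (q ∉ I × q ≢ x × q ≢ y))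
      closes x≢y {q} col q-cases = col₂⇒¬triangle col
        (∈⊕-old (∈⊕-old ∈⊕-new)) (∈⊕-old ∈⊕-new) ∈⊕-new (outside⇒~ x∉ y∉ x≢y)
        ([ (λ { refl → x~v }) , (λ (q∉ , q≢x , _) → outside⇒~ x∉ q∉ (≢-sym q≢x)) ]′ q-cases)
        ([ (λ { refl → y~v }) , (λ (q∉ , _ , q≢y) → outside⇒~ y∉ q∉ (≢-sym q≢y)) ]′ q-cases)

    -- The isomorphism with the corona.

    C : Graph (Fin ∣ I ∣ ⊎ Fin ∣ I ∣)
    C = corona (complete ∣ I ∣)

    foot : ∀ {v} → v ∉ I → Fin ∣ I ∣
    foot v∉ = rank (proj₁ (proj₂ (dominated max v∉)))

    foot-unique : ∀ {u v} (v∉ : v ∉ I) (u∈ : u ∈ I) → v ~ u → foot v∉ ≡ rank u∈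
    foot-unique v∉ u∈ v~u with dominated max v∉
    ... | w , w∈ , v~w = rank-cong w∈ u∈ (unique v∉ w∈ u∈ v~w v~u)

    ~foot : ∀ {v} (v∉ : v ∉ I) → v ~ unrank I (foot v∉)
    ~foot v∉ with dominated max v∉
    ... | w , w∈ , v~w = subst (_ ~_) (sym (unrank-rank w∈)) v~w

    -- Elements of I become leaves, and an outside vertex becomes the hub indexed by its foot. The
    -- decision is an argument so that adjacency can be checked by cases on it.
    place : ∀ {v} → Dec (v ∈ I) → Fin ∣ I ∣ ⊎ Fin ∣ I ∣
    place (yes v∈) = inj₂ (rank v∈)
    place (no  v∉) = inj₁ (foot v∉)

    place-adj : ∀ {u v} (u? : Dec (u ∈ I)) (v? : Dec (v ∈ I)) → u ~ v ⇔ Adj C (place u?) (place v?)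
    place-adj (yes u∈) (yes v∈) = mk⇔ (λ u~v → indep max u∈ v∈ u~v) λ ()
    place-adj (yes u∈) (no  v∉) = mk⇔
      (λ u~v → sym (foot-unique v∉ u∈ (symm G u~v)))
      (λ eq → symm G (subst (_ ~_) (trans (cong (unrank I) (sym eq)) (unrank-rank u∈)) (~foot v∉)))
    place-adj (no  u∉) (yes v∈) = mk⇔
      (foot-unique u∉ v∈)
      (λ eq → subst (_ ~_) (trans (cong (unrank I) eq) (unrank-rank v∈)) (~foot u∉))
    -- Outside vertices are adjacent exactly when distinct, and distinct ones have distinct feet.
    place-adj (no  u∉) (no  v∉) = mk⇔
      (λ u~v eq → ~⇒≢ u~v (same-foot⇒≡ (unrank∈ I (foot v∉)) u∉ v∉
        (subst (λ i → _ ~ unrank I i) eq (~foot u∉)) (~foot v∉)))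
      (λ neq → outside⇒~ u∉ v∉ λ { refl → neq (trans (foot-unique u∉ (unrank∈ I (foot v∉)) (~foot v∉)) (rank-unrank I (foot v∉))) })

    to : Fin n → Fin ∣ I ∣ ⊎ Fin ∣ I ∣
    to v = place (v ∈? I)

    -- This inverts `foot`: I has a second element, so connectivity provides an edge at
    -- `unrank I i`.
    bud : ∀ i → ∃ λ z → z ~ unrank I i
    bud i with ∣S∣>0⇒nonempty (I - unrank I i) (ℕ.≤-pred
      (ℕ.≤-trans (ℕ.≤-trans (s≤s (s≤s z≤n)) 3≤a)
        (ℕ.≤-reflexive (trans (sym (size max)) (∣S∣≡1+∣S-q∣ I (unrank∈ I i))))))
    ... | w , w∈ = neighbor (≢-sym (proj₂ (∈-⁻ w∈)))

    bud∉ : ∀ i → proj₁ (bud i) ∉ I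
    bud∉ i z∈ = indep max z∈ (unrank∈ I i) (proj₂ (bud i))

    from : Fin ∣ I ∣ ⊎ Fin ∣ I ∣ → Fin n
    from (inj₁ i) = proj₁ (bud i)
    from (inj₂ i) = unrank I i

    to-from : ∀ s → to (from s) ≡ s
    to-from (inj₁ i) with proj₁ (bud i) ∈? I
    ... | yes z∈ = contradiction z∈ (bud∉ i)
    ... | no  z∉ = cong inj₁ (trans (foot-unique z∉ (unrank∈ I i) (proj₂ (bud i))) (rank-unrank I i))
    to-from (inj₂ i) with unrank I i ∈? I
    ... | yes u∈ = cong inj₂ (trans (rank-cong u∈ (unrank∈ I i) refl) (rank-unrank I i))
    ... | no  u∉ = contradiction (unrank∈ I i) u∉

    from-to : ∀ v → from (to v) ≡ v
    from-to v with v ∈? I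
    ... | yes v∈ = unrank-rank v∈
    ... | no  v∉ = same-foot⇒≡ (unrank∈ I (foot v∉)) (bud∉ (foot v∉)) v∉
      (proj₂ (bud (foot v∉))) (~foot v∉)

    iso : G ≅ C
    iso = record
      { bijection = mk↔ₛ′ to from to-from from-to
      ; adjacency = λ u v → place-adj (u ∈? I) (v ∈? I)
      }

  iso-corona : HueOrder G 1 a → G ≅ corona (complete a)
  iso-corona (S , (col , _) , ∣S∣≡a) with pendant (record { indep = col₁⇒indep col ; size = ∣S∣≡a })
  ... | _ , pend = subst (λ s → G ≅ corona (complete s)) (size (Pendant.max pend)) (Recognition.iso pend)

-- Coronas of complete graphs are connected and well-hued.

module Converse {n a : ℕ} (G : Graph (Fin n)) (G≅C : G ≅ corona (complete a)) where

  open Colorings G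
  open _≅_ G≅C
  open Inverse bijection using (to; from; strictlyInverseˡ; strictlyInverseʳ)

  C : Graph (Fin a ⊎ Fin a)
  C = corona (complete a)

  hub leaf : Fin a → Fin n
  hub  = from ∘ inj₁
  leaf = from ∘ inj₂

  from-injective : ∀ {s t} → from s ≡ from t → s ≡ t
  from-injective {s} {t} eq =
    trans (sym (strictlyInverseˡ s)) (trans (cong to eq) (strictlyInverseˡ t))

  from-adj : ∀ {s t} → Adj C s t → from s ~ from t
  from-adj {s} {t} st = Equivalence.from (adjacency (from s) (from t))
    (subst₂ (Adj C) (sym (strictlyInverseˡ s)) (sym (strictlyInverseˡ t)) st)

  to-adj : ∀ {u v} → u ~ v → Adj C (to u) (to v)
  to-adj {u} {v} = Equivalence.to (adjacency u v)

  from-to∈ : ∀ {S v} → v ∈ S → from (to v) ∈ S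
  from-to∈ {S} {v} = subst (_∈ S) (sym (strictlyInverseʳ v))

  connected : Connected G
  connected u v = subst₂ (Star _~_) (strictlyInverseʳ u) (strictlyInverseʳ v)
    (gmap from from-adj (path (to u) (to v)))
    where
    hub-path : ∀ i j → Star (Adj C) (inj₁ i) (inj₁ j)
    hub-path i j with i ≟ j
    ... | yes refl = ε
    ... | no  i≢j  = i≢j ◅ ε

    path : ∀ s t → Star (Adj C) s t
    path (inj₁ i) (inj₁ j) = hub-path i j
    path (inj₁ i) (inj₂ j) = hub-path i j ◅◅ refl ◅ ε
    path (inj₂ i) (inj₁ j) = refl ◅ hub-path i j
    path (inj₂ i) (inj₂ j) = refl ◅ hub-path i j ◅◅ refl ◅ ε

  module _ (S : Subset n) where

    hubs leaves : Subset a
    hubs   = tabulate (lookup S ∘ hub)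
    leaves = tabulate (lookup S ∘ leaf)

  module _ {S : Subset n} {i : Fin a} where

    ∈hubs⁺ : hub i ∈ S → i ∈ hubs S
    ∈hubs⁺ h∈ = lookup⇒[]= i _ (trans (lookup∘tabulate _ i) ([]=⇒lookup h∈))

    ∈hubs⁻ : i ∈ hubs S → hub i ∈ S
    ∈hubs⁻ i∈ = lookup⇒[]= (hub i) S (trans (sym (lookup∘tabulate _ i)) ([]=⇒lookup i∈))

    ∈leaves⁺ : leaf i ∈ S → i ∈ leaves S
    ∈leaves⁺ l∈ = lookup⇒[]= i _ (trans (lookup∘tabulate _ i) ([]=⇒lookup l∈))

    ∈leaves⁻ : i ∈ leaves S → leaf i ∈ S
    ∈leaves⁻ i∈ = lookup⇒[]= (leaf i) S (trans (sym (lookup∘tabulate _ i)) ([]=⇒lookup i∈))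

  lookup-hubs++leaves : ∀ S i → lookup (hubs S ++ leaves S) i ≡ lookup S (from (splitAt a i))
  lookup-hubs++leaves S i = trans (lookup-splitAt a (hubs S) (leaves S) i) (lemma (splitAt a i))
    where
    lemma : ∀ s → [ lookup (hubs S) , lookup (leaves S) ]′ s ≡ lookup S (from s)
    lemma (inj₁ i) = lookup∘tabulate _ i
    lemma (inj₂ i) = lookup∘tabulate _ i

  -- The isomorphism, followed by `join`, carries S onto `hubs S ++ leaves S` in Fin (a + a);
  -- injections both ways compare the orders.
  ∣S∣≡hubs+leaves : ∀ S → ∣ S ∣ ≡ ∣ hubs S ∣ + ∣ leaves S ∣
  ∣S∣≡hubs+leaves S = trans (ℕ.≤-antisym
    (∣∣-mono S (hubs S ++ leaves S) (join a a ∘ to) join-to-injective λ {x} x∈ →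
      lookup⇒[]= _ _ (trans (lookup-hubs++leaves S _)
        (trans (cong (lookup S) (trans (cong from (splitAt-join a a (to x))) (strictlyInverseʳ x)))
          ([]=⇒lookup x∈))))
    (∣∣-mono (hubs S ++ leaves S) S (from ∘ splitAt a) from-split-injective λ {i} i∈ →
      lookup⇒[]= _ S (trans (sym (lookup-hubs++leaves S i)) ([]=⇒lookup i∈))))
    (∣++∣ (hubs S) (leaves S))
    where
    join-to-injective : ∀ {x y} → join a a (to x) ≡ join a a (to y) → x ≡ y
    join-to-injective {x} {y} eq = trans (sym (strictlyInverseʳ x)) (trans (cong from
      (trans (sym (splitAt-join a a (to x))) (trans (cong (splitAt a) eq) (splitAt-join a a (to y)))))
      (strictlyInverseʳ y))

    from-split-injective : ∀ {i j} → from (splitAt a i) ≡ from (splitAt a j) → i ≡ j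
    from-split-injective {i} {j} eq = trans (sym (join-splitAt a a i))
      (trans (cong (join a a) (from-injective eq)) (join-splitAt a a j))

  ⊂⊕ : ∀ {S : Subset n} {q} → q ∉ S → S ⊂ S ⊕ q
  ⊂⊕ q∉ = ∈⊕-old , _ , ∈⊕-new , q∉

  -- The hubs in S form a clique, so their colors are distinct.
  col⇒∣hubs∣≤ : ∀ {k S} → Col k S → ∣ hubs S ∣ ≤ k
  col⇒∣hubs∣≤ {k} {S} (c , proper) = injective⇒≤ {f = color} λ {i} {j} eq →
    decidable-stable (i ≟ j) λ i≢j →
      proper (_ , h∈ i) (_ , h∈ j) (from-adj (i≢j ∘ unrank-injective (hubs S))) eq
    where
    h∈ : ∀ i → hub (unrank (hubs S) i) ∈ S
    h∈ i = ∈hubs⁻ (unrank∈ (hubs S) i)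

    color : Fin ∣ hubs S ∣ → Fin k
    color i = c (_ , h∈ i)

  -- Hubs are colored by rank, and each leaf avoids the color of its hub, which takes a second
  -- color; hence the form 2 + k.
  ∣hubs∣≤⇒col : ∀ {k S} → ∣ hubs S ∣ ≤ 2 + k → Col (2 + k) S
  ∣hubs∣≤⇒col {k} {S} ≤k = (λ (v , _) → paint (to v)) ,
    λ (_ , u∈) (_ , v∈) u~v → proper _ _ (from-to∈ u∈) (from-to∈ v∈) (to-adj u~v)
    where
    other : Fin (2 + k) → Fin (2 + k)
    other zero    = suc zero
    other (suc _) = zero

    other≢ : ∀ c → other c ≢ c
    other≢ zero    ()
    other≢ (suc _) ()

    hub-color : ∀ {i} → Dec (i ∈ hubs S) → Fin (2 + k)
    hub-color (yes i∈) = inject≤ (rank i∈) ≤k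
    -- A hub outside S may get any color: only its leaf can still refer to it, and `other` differs
    -- from every color.
    hub-color (no _)   = zero

    hub-color≢ : ∀ {i j} (i? : Dec (i ∈ hubs S)) (j? : Dec (j ∈ hubs S)) → i ∈ hubs S → j ∈ hubs S →
      i ≢ j → hub-color i? ≢ hub-color j?
    hub-color≢ (no i∉)  _        i∈ _  _   = contradiction i∈ i∉
    hub-color≢ (yes _)  (no j∉)  _  j∈ _   = contradiction j∈ j∉
    hub-color≢ (yes i∈) (yes j∈) _  _  i≢j =
      i≢j ∘ rank-injective i∈ j∈ ∘ inject≤-injective ≤k ≤k (rank i∈) (rank j∈)

    paint : Fin a ⊎ Fin a → Fin (2 + k)
    paint (inj₁ i) = hub-color (i ∈? hubs S)
    paint (inj₂ i) = other (hub-color (i ∈? hubs S))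

    proper : ∀ s t → from s ∈ S → from t ∈ S → Adj C s t → paint s ≢ paint t
    proper (inj₁ i) (inj₁ j) i∈ j∈ i≢j  = hub-color≢ (i ∈? hubs S) (j ∈? hubs S) (∈hubs⁺ i∈) (∈hubs⁺ j∈) i≢j
    proper (inj₁ i) (inj₂ j) _  _  refl = other≢ _ ∘ sym
    proper (inj₂ i) (inj₁ j) _  _  refl = other≢ _

  module _ {k S} (maximal : MaximalColorable G (2 + k) S) where

    -- Adding a leaf leaves the hubs unchanged and so keeps colorability; maximality forces every
    -- leaf into S.
    ∣leaves∣≡a : ∣ leaves S ∣ ≡ a
    ∣leaves∣≡a = trans (cong ∣_∣ (⊆-antisym {i = leaves S} ⊆⊤ λ {i} _ → ∈leaves⁺ (leaf∈ i))) (∣⊤∣≡n a)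
      where
      leaf∈ : ∀ i → leaf i ∈ S
      leaf∈ i = decidable-stable (leaf i ∈? S) λ l∉ → proj₂ maximal _ (⊂⊕ l∉)
        (∣hubs∣≤⇒col (ℕ.≤-trans (p⊆q⇒∣p∣≤∣q∣ hubs⊆) (col⇒∣hubs∣≤ (proj₁ maximal))))
        where
        hubs⊆ : hubs (S ⊕ leaf i) ⊆ hubs S
        hubs⊆ j∈ with ∈⊕⁻ (∈hubs⁻ {S = S ⊕ leaf i} j∈)
        ... | inj₁ eq = contradiction (from-injective eq) λ ()
        ... | inj₂ h∈ = ∈hubs⁺ h∈

    -- If T had more hubs, S would have room for one more, so by maximality every hub of T would
    -- already be in S. Comparing two sets this way avoids computing the number of hubs.
    ∣hubs∣-largest : ∀ {T} → Col (2 + k) T → ∣ hubs T ∣ ≤ ∣ hubs S ∣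
    ∣hubs∣-largest {T} colT = ℕ.≮⇒≥ λ S<T → ℕ.<⇒≱ S<T (p⊆q⇒∣p∣≤∣q∣ {p = hubs T} λ {i} i∈T →
      decidable-stable (i ∈? hubs S) λ i∉S → proj₂ maximal _ (⊂⊕ (i∉S ∘ ∈hubs⁺))
        (∣hubs∣≤⇒col (ℕ.≤-trans (p⊆q⇒∣p∣≤∣q∣ hubs⊆)
          (ℕ.≤-trans (ℕ.≤-reflexive (∣S⊕q∣ (hubs S) i∉S)) (ℕ.≤-trans S<T (col⇒∣hubs∣≤ colT))))))
      where
      hubs⊆ : ∀ {i} → hubs (S ⊕ hub i) ⊆ hubs S ⊕ i
      hubs⊆ {i} j∈ with ∈⊕⁻ (∈hubs⁻ {S = S ⊕ hub i} j∈)
      ... | inj₁ eq with from-injective eq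
      ...   | refl = ∈⊕-new
      hubs⊆ j∈ | inj₂ h∈ = ∈⊕-old (∈hubs⁺ h∈)

  -- An independent set never contains a leaf together with its hub.
  ∣leaves∣≤∣∁hubs∣ : ∀ {S} → Indep S → ∣ leaves S ∣ ≤ ∣ ∁ (hubs S) ∣
  ∣leaves∣≤∣∁hubs∣ {S} indep = p⊆q⇒∣p∣≤∣q∣ λ i∈ →
    x∉p⇒x∈∁p λ i∈′ → indep (∈hubs⁻ i∈′) (∈leaves⁻ i∈) (from-adj refl)

  ∣∣+∣∁∣ : ∀ (p : Subset a) → ∣ p ∣ + ∣ ∁ p ∣ ≡ a
  ∣∣+∣∁∣ p = trans (cong (∣ p ∣ +_) (∣∁p∣≡n∸∣p∣ p)) (ℕ.m+[n∸m]≡n (∣p∣≤n p))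

  indep⇒∣∣≤a : ∀ {S} → Indep S → ∣ S ∣ ≤ a
  indep⇒∣∣≤a {S} indep = begin
    ∣ S ∣                         ≡⟨ ∣S∣≡hubs+leaves S ⟩
    ∣ hubs S ∣ + ∣ leaves S ∣     ≤⟨ ℕ.+-monoʳ-≤ ∣ hubs S ∣ (∣leaves∣≤∣∁hubs∣ indep) ⟩
    ∣ hubs S ∣ + ∣ ∁ (hubs S) ∣   ≡⟨ ∣∣+∣∁∣ (hubs S) ⟩
    a                             ∎
    where open ℕ.≤-Reasoning

  maximal₁⇒∣∣≡a : ∀ {S} → MaximalColorable G 1 S → ∣ S ∣ ≡ a
  maximal₁⇒∣∣≡a {S} (col , maximal) = ℕ.≤-antisym (indep⇒∣∣≤a indep) (begin
    a                             ≡⟨ ∣∣+∣∁∣ (hubs S) ⟨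
    ∣ hubs S ∣ + ∣ ∁ (hubs S) ∣   ≤⟨ ℕ.+-monoʳ-≤ ∣ hubs S ∣ (p⊆q⇒∣p∣≤∣q∣ ∁⊆) ⟩
    ∣ hubs S ∣ + ∣ leaves S ∣     ≡⟨ ∣S∣≡hubs+leaves S ⟨
    ∣ S ∣                         ∎)
    where
    open ℕ.≤-Reasoning

    indep : Indep S
    indep = col₁⇒indep col

    -- The only neighbor of a leaf is its hub, so if the hub is absent, maximality forces the leaf
    -- in.
    ∁⊆ : ∁ (hubs S) ⊆ leaves S
    ∁⊆ {i} i∈ = ∈leaves⁺ (decidable-stable (leaf i ∈? S) λ l∉ → maximal _ (⊂⊕ l∉)
      (indep⇒col₁ (indep-⊕ indep λ v∈ l~v → only-hub _ (from-to∈ v∈)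
        (subst (λ s → Adj C s (to _)) (strictlyInverseˡ (inj₂ i)) (to-adj l~v)))))
      where
      only-hub : ∀ s → from s ∈ S → ¬ Adj C (inj₂ i) s
      only-hub (inj₁ _) h∈ refl = x∈∁p⇒x∉p i∈ (∈hubs⁺ h∈)

  wellHued : WellHued G
  wellHued (suc zero)    _ S T maxS maxT = trans (maximal₁⇒∣∣≡a maxS) (sym (maximal₁⇒∣∣≡a maxT))
  wellHued (suc (suc k)) _ S T maxS maxT = begin
    ∣ S ∣                       ≡⟨ ∣S∣≡hubs+leaves S ⟩
    ∣ hubs S ∣ + ∣ leaves S ∣   ≡⟨ cong₂ _+_
      (ℕ.≤-antisym (∣hubs∣-largest maxT (proj₁ maxS)) (∣hubs∣-largest maxS (proj₁ maxT)))
      (trans (∣leaves∣≡a maxS) (sym (∣leaves∣≡a maxT))) ⟩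
    ∣ hubs T ∣ + ∣ leaves T ∣   ≡⟨ ∣S∣≡hubs+leaves T ⟨
    ∣ T ∣                       ∎
    where open ≡-Reasoning

  -- Sets attaining the orders a and a + 2.

  largest⇒maximal : ∀ {k S} → Col k S → (∀ T → Col k T → ∣ T ∣ ≤ ∣ S ∣) → MaximalColorable G k S
  largest⇒maximal col largest = col , λ T S⊂T colT → ℕ.<⇒≱ (p⊂q⇒∣p∣<∣q∣ S⊂T) (largest T colT)

  -- All leaves together with the hubs indexed by P. The empty P serves for one color, a two-element
  -- P for two colors.
  leafy : Subset a → Subset n
  leafy P = tabulate ([ lookup P , const true ]′ ∘ to)

  hubs-leafy : ∀ P → hubs (leafy P) ≡ P
  hubs-leafy P = trans (tabulate-cong λ i → trans (lookup∘tabulate _ (hub i))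
    (cong [ lookup P , const true ]′ (strictlyInverseˡ (inj₁ i)))) (tabulate∘lookup P)

  ∣leafy∣ : ∀ P → ∣ leafy P ∣ ≡ ∣ P ∣ + a
  ∣leafy∣ P = trans (∣S∣≡hubs+leaves (leafy P)) (cong₂ _+_ (cong ∣_∣ (hubs-leafy P))
    (trans (cong ∣_∣ (⊆-antisym {i = leaves (leafy P)} ⊆⊤ λ {i} _ → ∈leaves⁺ (leaf∈ i))) (∣⊤∣≡n a)))
    where
    leaf∈ : ∀ i → leaf i ∈ leafy P
    leaf∈ i = lookup⇒[]= (leaf i) _ (trans (lookup∘tabulate _ (leaf i))
      (cong [ lookup P , const true ]′ (strictlyInverseˡ (inj₂ i))))

  hueOrder₁ : HueOrder G 1 a
  hueOrder₁ = leafy ⊥ , largest⇒maximal (indep⇒col₁ λ u∈ v∈ u~v →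
      independent _ _ (from-to∈ u∈) (from-to∈ v∈) (to-adj u~v))
    (λ T colT → subst (∣ T ∣ ≤_) (sym size) (indep⇒∣∣≤a (col₁⇒indep colT))) , size
    where
    size : ∣ leafy ⊥ ∣ ≡ a
    size = trans (∣leafy∣ ⊥) (cong (_+ a) (∣⊥∣≡0 a))

    hub∉ : ∀ {i} → hub i ∉ leafy ⊥
    hub∉ h∈ = ∉⊥ (subst (_ ∈_) (hubs-leafy ⊥) (∈hubs⁺ h∈))

    independent : ∀ s t → from s ∈ leafy ⊥ → from t ∈ leafy ⊥ → ¬ Adj C s t
    independent (inj₁ _) _        s∈ _  _ = hub∉ s∈
    independent (inj₂ _) (inj₁ _) _  t∈ _ = hub∉ t∈

  hueOrder₂ : (P : Subset a) → ∣ P ∣ ≡ 2 → HueOrder G 2 (a + 2)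
  hueOrder₂ P ∣P∣≡2 = leafy P , largest⇒maximal
    (∣hubs∣≤⇒col (ℕ.≤-reflexive (trans (cong ∣_∣ (hubs-leafy P)) ∣P∣≡2)))
    (λ T colT → begin
      ∣ T ∣                       ≡⟨ ∣S∣≡hubs+leaves T ⟩
      ∣ hubs T ∣ + ∣ leaves T ∣   ≤⟨ ℕ.+-mono-≤ (col⇒∣hubs∣≤ colT) (∣p∣≤n (leaves T)) ⟩
      2 + a                       ≡⟨ cong (_+ a) ∣P∣≡2 ⟨
      ∣ P ∣ + a                   ≡⟨ ∣leafy∣ P ⟨
      ∣ leafy P ∣                 ∎) ,
    trans (∣leafy∣ P) (trans (cong (_+ a) ∣P∣≡2) (ℕ.+-comm 2 a))
    where open ℕ.≤-Reasoning

-- Combining the two directions.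

pair : ∀ {a} → 2 ≤ a → ∃ λ (P : Subset a) → ∣ P ∣ ≡ 2
pair {suc (suc a)} (s≤s (s≤s _)) = inside ∷ inside ∷ ⊥ , cong (2 +_) (∣⊥∣≡0 a)

theorem2 : ∀ (a : ℕ) → 3 ≤ a → ∀ {n : ℕ} (G : Graph (Fin n)) →
    (Connected G × WellHued G × HueOrder G 1 a × HueOrder G 2 (a + 2)) ⇔ (G ≅ corona (complete a))
theorem2 a 3≤a G = mk⇔
  (λ { (connected , wellHued , hue₁@(S₁ , max₁ , ∣S₁∣≡a) , (S₂ , max₂ , ∣S₂∣≡a+2)) →
    Forward.iso-corona G a 3≤a connected
      -- Well-huedness transfers the order of the given maximal set to all maximal sets.
      (λ S max → trans (wellHued 1 (s≤s z≤n) S S₁ max max₁) ∣S₁∣≡a)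
      (λ S max → trans (wellHued 2 (s≤s z≤n) S S₂ max max₂) ∣S₂∣≡a+2)
      hue₁ })
  (λ G≅C → let open Converse G G≅C ; P , ∣P∣≡2 = pair (ℕ.<⇒≤ 3≤a) in
    connected , wellHued , hueOrder₁ , hueOrder₂ P ∣P∣≡2)
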